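{- There exist a large set of H-designs LH$(11,g,5,4)$ and a large set of H-designs LH$(12,g,6,5)$ for each integer $g\geq 2$, with possible exceptions when $g\in\{3,5,7,9,11,13\}$.
   Context: An H-design H$(n,g,k,t)$ is a triple $(Q,G,B)$ where $Q$ is a set of $ng$ points, $G$ is a partition of $Q$ into $n$ groups of size $g$, and $B$ is a set of $k$-subsets of $Q$ (blocks) such that each block meets each group in at most one point and any $t$ points from $t$ distinct groups lie in exactly one block. A large set of H-designs LH$(n,g,k,t)$ is a partition of the set of all $k$-subsets of $Q$ meeting each group of $G$ in at most one point into pairwise disjoint block sets, each of which forms (with $Q$ and $G$) an H-design H$(n,g,k,t)$. -}

module Defs where

open import Data.Fin.Base using (Fin)
open import Data.Fin.Subset using (Subset; _∈_; _⊆_; _∩_; ∣_∣)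
open import Data.Nat.Base using (ℕ; _*_; _≤_)
open import Data.Product using (_×_; ∃!)
open import Level using (0ℓ; suc)
open import Relation.Binary.PropositionalEquality using (_≡_)
open import Relation.Unary using (Pred; Satisfiable) renaming (_∈_ to _∈ₚ_)

record IsGroupPartition (n g : ℕ) (G : Fin n → Subset (n * g)) : Set where
  field
    group-size  : ∀ i → ∣ G i ∣ ≡ g
    group-cover : ∀ x → ∃! _≡_ λ i → x ∈ G i

-- The k-subsets of points meeting each group in at most one point;
-- equivalently, sets of k points from k distinct groups.
Transversal : ∀ {n v} → (Fin n → Subset v) → ℕ → Pred (Subset v) 0ℓ
Transversal G k S = ∣ S ∣ ≡ k × (∀ i → ∣ S ∩ G i ∣ ≤ 1)

record IsHDesign (n g k t : ℕ) (G : Fin n → Subset (n * g))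
                 (B : Pred (Subset (n * g)) 0ℓ) : Set where
  field
    isGroupPartition  : IsGroupPartition n g G
    block-transversal : ∀ b → b ∈ₚ B → b ∈ₚ Transversal G k
    block-unique      : ∀ T → T ∈ₚ Transversal G t →
                        ∃! _≡_ λ b → b ∈ₚ B × T ⊆ b

-- The cells of the partition are indexed by Fin m. Every block of a cell is
-- transversal (by isHDesign), so partition and nonempty make the cells a
-- partition of exactly the transversal k-subsets.
record LH (n g k t : ℕ) : Set (suc 0ℓ) where
  field
    G                : Fin n → Subset (n * g)
    -- Not redundant: isHDesign is vacuous when m is 0.
    isGroupPartition : IsGroupPartition n g G
    m                : ℕ
    B                : Fin m → Pred (Subset (n * g)) 0ℓ
    isHDesign        : ∀ j → IsHDesign n g k t G (B j)
    nonempty         : ∀ j → Satisfiable (B j)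
    partition        : ∀ S → S ∈ₚ Transversal G k → ∃! _≡_ λ j → S ∈ₚ B j

{-# OPTIONS --safe #-}

-- A g-fold large set is a family of Steiner systems S(t,t+1,n) on n points
-- (repetitions allowed) such that every (t+1)-set is a block of exactly g of
-- them.  It yields an LH(n,g,t+1,t): a transversal (t+1)-set with support I and
-- second coordinates summing to s goes to the cell of the (s mod g)-th system
-- among those having I as a block.  Indeed, given a transversal t-set with
-- support J, a system determines the missing point of I ⊃ J, and its rank among
-- the systems containing I determines the missing second coordinate.
--
-- Families can be concatenated, adding their folds, so 2-fold and 3-fold large
-- sets of S(5,6,12) give all folds g ≥ 2.  Taking derived systems at a point
-- passes from S(5,6,12) to S(4,5,11).
module Submission where

open import Defs
open import Data.Bool.Base using (Bool; true; false; not; _∧_)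
open import Data.Bool.Properties using (∧-conicalˡ; ∧-conicalʳ; T-≡)
open import Data.Fin.Base using (Fin; zero; suc; toℕ; fromℕ<; splitAt; _↑ˡ_; _↑ʳ_)
open import Data.Fin.Properties
  using (toℕ<n; toℕ-fromℕ<; toℕ-injective; splitAt⁻¹-↑ˡ; splitAt⁻¹-↑ʳ)
open import Data.Fin.Subset
  using (Subset; inside; outside; _∈_; _⊆_; _∩_; ∣_∣; ⊤; ⊥; ⁅_⁆; ∁)
open import Data.Fin.Subset.Properties
  using (∣⊥∣≡0; ∣⊤∣≡n; ∣⁅x⁆∣≡1; ∩-identityʳ; ∩-zeroʳ; ∉⊥; x∈⁅x⁆; x∈⁅y⁆⇒x≡y;
         drop-∷-⊆; ⊥⊆)
open import Data.List.Base as List using (List; _∷_; [])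
open import Data.List.Membership.Propositional using (_∉_)
open import Data.Maybe.Base using (Maybe; just; nothing; is-just)
open import Data.Nat.Base
  using (ℕ; zero; suc; _+_; _*_; _≤_; _<_; z≤n; s≤s; s≤s⁻¹; pred; _≡ᵇ_; NonZero)
open import Data.Nat.ListAction using (sum)
open import Data.Nat.DivMod
  using (_/_; _%_; m%n<n; m<n⇒m%n≡m; m%n%n≡m%n; [m+kn]%n≡m%n; %-distribˡ-+)
open import Data.Nat.Properties
  using (≤-reflexive; ≤-trans; 1+n≰n; m≤n⇒m≤1+n; n≤0⇒n≡0; suc-injective;
         suc-pred; +-assoc; +-comm; +-identityʳ; *-suc; ≡ᵇ⇒≡)
open import Data.Product using (∃; ∃!; _×_; _,_; proj₁; proj₂)
open import Data.Sum.Base using (inj₁; inj₂)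
open import Data.Vec.Base as Vec
  using (Vec; []; _∷_; _++_; _∷ʳ_; lookup; map; replicate; tabulate; iterate;
         toList; _[_]≔_)
open import Data.Vec.Properties
  using (lookup-map; lookup∘tabulate; lookup-replicate; lookup-++ˡ; lookup-++ʳ;
         lookup⇒[]=; []=⇒lookup; map-[]≔; map-∘; map-++;
         zipWith-++)
open import Data.Vec.Relation.Binary.Pointwise.Inductive as Pointwise
  using (Pointwise; []; _∷_)
open import Data.Vec.Relation.Unary.All as All using (All; []; _∷_)
import Data.Vec.Relation.Unary.All.Properties as Allₚ
open import Function.Base using (_∘_; id)
open import Function.Bundles using (Equivalence)
open import Relation.Binary.PropositionalEquality
open import Relation.Nullary using (contradiction)

private
  variable
    k m n t g : ℕ

-- Sizes and inclusions of finite subsets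

∣p++q∣≡∣p∣+∣q∣ : (p : Subset m) (q : Subset n) → ∣ p ++ q ∣ ≡ ∣ p ∣ + ∣ q ∣
∣p++q∣≡∣p∣+∣q∣ []            q = refl
∣p++q∣≡∣p∣+∣q∣ (inside  ∷ p) q = cong suc (∣p++q∣≡∣p∣+∣q∣ p q)
∣p++q∣≡∣p∣+∣q∣ (outside ∷ p) q = ∣p++q∣≡∣p∣+∣q∣ p q

∣p∣≡0⇒p≡⊥ : (p : Subset n) → ∣ p ∣ ≡ 0 → p ≡ ⊥
∣p∣≡0⇒p≡⊥ []            _ = refl
∣p∣≡0⇒p≡⊥ (outside ∷ p) e = cong (outside ∷_) (∣p∣≡0⇒p≡⊥ p e)

∣p[i]≔inside∣ : (p : Subset n) (i : Fin n) → lookup p i ≡ outside →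
                ∣ p [ i ]≔ inside ∣ ≡ suc ∣ p ∣
∣p[i]≔inside∣ (outside ∷ p) zero    _ = refl
∣p[i]≔inside∣ (inside  ∷ p) (suc i) e = cong suc (∣p[i]≔inside∣ p i e)
∣p[i]≔inside∣ (outside ∷ p) (suc i) e = ∣p[i]≔inside∣ p i e

++-mono-⊆ : {p p′ : Subset m} {q q′ : Subset n} →
            p ⊆ p′ → q ⊆ q′ → p ++ q ⊆ p′ ++ q′
++-mono-⊆ {p = []}    {[]}    p⊆p′ q⊆q′ x∈ = q⊆q′ x∈
++-mono-⊆ {p = _ ∷ _} {_ ∷ _} p⊆p′ q⊆q′ Vec.here with p⊆p′ Vec.here
... | Vec.here = Vec.here
++-mono-⊆ {p = _ ∷ _} {_ ∷ _} p⊆p′ q⊆q′ (Vec.there x∈) =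
  Vec.there (++-mono-⊆ (drop-∷-⊆ p⊆p′) q⊆q′ x∈)

++-⊆ˡ : {p p′ : Subset m} {q q′ : Subset n} → p ++ q ⊆ p′ ++ q′ → p ⊆ p′
++-⊆ˡ {p = _ ∷ _} {_ ∷ _} h Vec.here with h Vec.here
... | Vec.here = Vec.here
++-⊆ˡ {p = _ ∷ _} {_ ∷ _} h (Vec.there x∈) = Vec.there (++-⊆ˡ (drop-∷-⊆ h) x∈)

++-⊆ʳ : (p p′ : Subset m) {q q′ : Subset n} → p ++ q ⊆ p′ ++ q′ → q ⊆ q′
++-⊆ʳ []      []       h = h
++-⊆ʳ (_ ∷ p) (_ ∷ p′) h = ++-⊆ʳ p p′ (drop-∷-⊆ h)

-- Rank and selection in a subset

rank : Subset n → Fin n → ℕ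
rank p             zero    = 0
rank (inside  ∷ p) (suc i) = suc (rank p i)
rank (outside ∷ p) (suc i) = rank p i

rank<∣p∣ : (p : Subset n) (i : Fin n) → lookup p i ≡ inside → rank p i < ∣ p ∣
rank<∣p∣ (inside  ∷ p) zero    _ = s≤s z≤n
rank<∣p∣ (inside  ∷ p) (suc i) e = s≤s (rank<∣p∣ p i e)
rank<∣p∣ (outside ∷ p) (suc i) e = rank<∣p∣ p i e

-- Ranks start at 0, so the members of a set of size `g` correspond to the residues modulo `g`. This
-- is how a total picks out a system.
select : (p : Subset n) (c : ℕ) → c < ∣ p ∣ →
         ∃! _≡_ λ i → lookup p i ≡ inside × rank p i ≡ c
select (inside ∷ p) zero _ =
  zero , (refl , refl) , λ { {zero} _ → refl }
select (inside ∷ p) (suc c) c< with select p c (s≤s⁻¹ c<)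
... | i , (e , r) , unique =
  suc i , (e , cong suc r) ,
  λ { {suc _} (e′ , r′) → cong suc (unique (e′ , suc-injective r′)) }
select (outside ∷ p) c c< with select p c c<
... | i , (e , r) , unique =
  suc i , (e , r) , λ { {suc _} h → cong suc (unique h) }

∣p∣≡1⇒∃! : (p : Subset n) → ∣ p ∣ ≡ 1 → ∃! _≡_ λ i → lookup p i ≡ inside
∣p∣≡1⇒∃! p ∣p∣≡1 with select p 0 (≤-reflexive (sym ∣p∣≡1))
... | i , (e , _) , unique =
  i , e , λ {j} e′ →
    unique (e′ , n≤0⇒n≡0 (s≤s⁻¹ (≤-trans (rank<∣p∣ p j e′) (≤-reflexive ∣p∣≡1))))

-- Multiplying s by g - 1 gives an additive inverse of s modulo g without subtraction.
+-%-solve : ∀ g .{{_ : NonZero g}} s c → c < g →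
            ∃! _≡_ λ (a : Fin g) → (toℕ a + s) % g ≡ c
+-%-solve g s c c<g = a , solves , unique
  where
  open ≡-Reasoning
  s⁻ = s * pred g

  s+s⁻≡sg : s + s⁻ ≡ s * g
  s+s⁻≡sg = trans (sym (*-suc s (pred g))) (cong (s *_) (suc-pred g))

  -- Adding `y` and then `z` fixes residues. This serves twice, with `s` and `s⁻` in either order:
  -- for existence and for uniqueness.
  absorb : ∀ x y z → y + z ≡ s * g → x < g → ((x + y) % g + z) % g ≡ x
  absorb x y z y+z≡sg x<g = begin
    ((x + y) % g + z) % g          ≡⟨ %-distribˡ-+ ((x + y) % g) z g ⟩
    ((x + y) % g % g + z % g) % g  ≡⟨ cong (λ r → (r + z % g) % g) (m%n%n≡m%n (x + y) g) ⟩
    ((x + y) % g + z % g) % g      ≡⟨ %-distribˡ-+ (x + y) z g ⟨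
    (x + y + z) % g                ≡⟨ cong (_% g) (+-assoc x y z) ⟩
    (x + (y + z)) % g              ≡⟨ cong (λ r → (x + r) % g) y+z≡sg ⟩
    (x + s * g) % g                ≡⟨ [m+kn]%n≡m%n x s g ⟩
    x % g                          ≡⟨ m<n⇒m%n≡m x<g ⟩
    x                              ∎

  a = fromℕ< (m%n<n (c + s⁻) g)

  solves : (toℕ a + s) % g ≡ c
  solves = begin
    (toℕ a + s) % g          ≡⟨ cong (λ r → (r + s) % g) (toℕ-fromℕ< _) ⟩
    ((c + s⁻) % g + s) % g   ≡⟨ absorb c s⁻ s (trans (+-comm s⁻ s) s+s⁻≡sg) c<g ⟩
    c                        ∎

  unique : ∀ {b} → (toℕ b + s) % g ≡ c → a ≡ b
  unique {b} e = toℕ-injective (begin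
    toℕ a                          ≡⟨ toℕ-fromℕ< _ ⟩
    (c + s⁻) % g                   ≡⟨ cong (λ r → (r + s⁻) % g) e ⟨
    ((toℕ b + s) % g + s⁻) % g     ≡⟨ absorb (toℕ b) s s⁻ s+s⁻≡sg (toℕ<n b) ⟩
    toℕ b                          ∎)

-- Transversals as partial words

-- Transversals are represented by words: the i-th letter is the second
-- coordinate of the point in group i, if there is one.
Word : ℕ → ℕ → Set
Word n g = Vec (Maybe (Fin g)) n

support : Word n g → Subset n
support = map is-just

total : Word n g → ℕ
total []            = 0
total (nothing ∷ w) = total w
total (just a  ∷ w) = toℕ a + total w

row : Maybe (Fin g) → Subset g
row nothing  = ⊥
row (just a) = ⁅ a ⁆

⟦_⟧ : Word n g → Subset (n * g)
⟦ [] ⟧    = []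
⟦ x ∷ w ⟧ = row x ++ ⟦ w ⟧

-- Points are numbered group by group: each group is a run of `g` consecutive points, matching the
-- rows concatenated in `⟦_⟧`.
group : ∀ g → Fin n → Subset (n * g)
group {suc n} g zero    = ⊤ {g} ++ ⊥ {n * g}
group {suc n} g (suc i) = ⊥ {g} ++ group g i

∣group∣ : (i : Fin n) → ∣ group g i ∣ ≡ g
∣group∣ {suc n} {g} zero
  rewrite ∣p++q∣≡∣p∣+∣q∣ (⊤ {g}) (⊥ {n * g}) | ∣⊤∣≡n g | ∣⊥∣≡0 (n * g) = +-identityʳ g
∣group∣ {suc n} {g} (suc i)
  rewrite ∣p++q∣≡∣p∣+∣q∣ (⊥ {g}) (group g i) | ∣⊥∣≡0 g = ∣group∣ {n} {g} i

∈-++ˡ : (p : Subset m) (q : Subset n) {x : Fin m} → x ∈ p → (x ↑ˡ n) ∈ p ++ q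
∈-++ˡ p q {x} x∈p = lookup⇒[]= _ _ (trans (lookup-++ˡ p q x) ([]=⇒lookup x∈p))

∈-++ˡ⁻ : (p : Subset m) (q : Subset n) {x : Fin m} → (x ↑ˡ n) ∈ p ++ q → x ∈ p
∈-++ˡ⁻ p q {x} x∈ = lookup⇒[]= _ _ (trans (sym (lookup-++ˡ p q x)) ([]=⇒lookup x∈))

∈-++ʳ : (p : Subset m) (q : Subset n) {x : Fin n} → x ∈ q → (m ↑ʳ x) ∈ p ++ q
∈-++ʳ p q {x} x∈q = lookup⇒[]= _ _ (trans (lookup-++ʳ p q x) ([]=⇒lookup x∈q))

∈-++ʳ⁻ : (p : Subset m) (q : Subset n) {x : Fin n} → (m ↑ʳ x) ∈ p ++ q → x ∈ q
∈-++ʳ⁻ p q {x} x∈ = lookup⇒[]= _ _ (trans (sym (lookup-++ʳ p q x)) ([]=⇒lookup x∈))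

group-cover : ∀ n g (x : Fin (n * g)) → ∃! _≡_ λ (i : Fin n) → x ∈ group g i
group-cover (suc n) g x with splitAt g x in eq
... | inj₁ a with refl ← splitAt⁻¹-↑ˡ {i = x} eq =
  zero , ∈-++ˡ ⊤ (⊥ {n * g}) (lookup⇒[]= a ⊤ (lookup-replicate a inside)) ,
  λ { {zero}  _  → refl
    ; {suc i} x∈ → contradiction (∈-++ˡ⁻ ⊥ (group g i) x∈) ∉⊥ }
... | inj₂ y with refl ← splitAt⁻¹-↑ʳ {i = x} eq with group-cover n g y
... | i , y∈ , unique =
  suc i , ∈-++ʳ (⊥ {g}) (group g i) y∈ ,
  λ { {zero}  x∈ → contradiction (∈-++ʳ⁻ (⊤ {g}) (⊥ {n * g}) x∈) ∉⊥
    ; {suc j} x∈ → cong suc (unique (∈-++ʳ⁻ (⊥ {g}) (group g j) x∈)) }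

group-isGroupPartition : ∀ n g → IsGroupPartition n g (group g)
group-isGroupPartition n g = record
  { group-size  = ∣group∣
  ; group-cover = group-cover n g
  }

∣row++∩group-zero∣ : (r : Subset g) (S : Subset (n * g)) →
                     ∣ (r ++ S) ∩ group g (zero {n}) ∣ ≡ ∣ r ∣
∣row++∩group-zero∣ {g} {n} r S
  rewrite zipWith-++ _∧_ r S (⊤ {g}) (⊥ {n * g})
        | ∩-identityʳ r | ∩-zeroʳ S
        | ∣p++q∣≡∣p∣+∣q∣ r (⊥ {n * g}) | ∣⊥∣≡0 (n * g) = +-identityʳ ∣ r ∣

∣row++∩group-suc∣ : (r : Subset g) (S : Subset (n * g)) (i : Fin n) →
                    ∣ (r ++ S) ∩ group g (suc i) ∣ ≡ ∣ S ∩ group g i ∣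
∣row++∩group-suc∣ {g} {n} r S i
  rewrite zipWith-++ _∧_ r S (⊥ {g}) (group g i)
        | ∩-zeroʳ r | ∣p++q∣≡∣p∣+∣q∣ (⊥ {g}) (S ∩ group g i) | ∣⊥∣≡0 g = refl

∣⟦w⟧∣≡∣support∣ : (w : Word n g) → ∣ ⟦ w ⟧ ∣ ≡ ∣ support w ∣
∣⟦w⟧∣≡∣support∣ [] = refl
∣⟦w⟧∣≡∣support∣ {g = g} (nothing ∷ w)
  rewrite ∣p++q∣≡∣p∣+∣q∣ (⊥ {g}) ⟦ w ⟧ | ∣⊥∣≡0 g = ∣⟦w⟧∣≡∣support∣ w
∣⟦w⟧∣≡∣support∣ (just a ∷ w)
  rewrite ∣p++q∣≡∣p∣+∣q∣ ⁅ a ⁆ ⟦ w ⟧ | ∣⁅x⁆∣≡1 a = cong suc (∣⟦w⟧∣≡∣support∣ w)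

∣row∣≤1 : (x : Maybe (Fin g)) → ∣ row x ∣ ≤ 1
∣row∣≤1 {g} nothing  rewrite ∣⊥∣≡0 g = z≤n
∣row∣≤1     (just a) = ≤-reflexive (∣⁅x⁆∣≡1 a)

⟦w⟧-meets-group : (w : Word n g) (i : Fin n) → ∣ ⟦ w ⟧ ∩ group g i ∣ ≤ 1
⟦w⟧-meets-group {suc n} {g} (x ∷ w) zero
  rewrite ∣row++∩group-zero∣ {g} {n} (row x) ⟦ w ⟧ = ∣row∣≤1 x
⟦w⟧-meets-group {suc n} {g} (x ∷ w) (suc i)
  rewrite ∣row++∩group-suc∣ {g} {n} (row x) ⟦ w ⟧ i = ⟦w⟧-meets-group w i

⟦w⟧-transversal : (w : Word n g) → ∣ support w ∣ ≡ k → Transversal (group {n} g) k ⟦ w ⟧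
⟦w⟧-transversal w e = trans (∣⟦w⟧∣≡∣support∣ w) e , ⟦w⟧-meets-group w

row-surjective : (r : Subset g) → ∣ r ∣ ≤ 1 → ∃ λ x → row x ≡ r
row-surjective []            _ = nothing , refl
row-surjective (inside  ∷ r) h =
  just zero , cong (inside ∷_) (sym (∣p∣≡0⇒p≡⊥ r (n≤0⇒n≡0 (s≤s⁻¹ h))))
row-surjective (outside ∷ r) h with row-surjective r h
... | nothing , e = nothing , cong (outside ∷_) e
... | just a  , e = just (suc a) , cong (outside ∷_) e

⟦⟧-surjective : ∀ n g (S : Subset (n * g)) →
                (∀ (i : Fin n) → ∣ S ∩ group g i ∣ ≤ 1) →
                ∃ λ (w : Word n g) → ⟦ w ⟧ ≡ S
⟦⟧-surjective zero    g [] _ = [] , refl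
⟦⟧-surjective (suc n) g S  h with Vec.splitAt g {n * g} S
... | r , S′ , refl
  with row-surjective r (subst (_≤ 1) (∣row++∩group-zero∣ {g} {n} r S′) (h zero))
     | ⟦⟧-surjective n g S′ (λ i → subst (_≤ 1) (∣row++∩group-suc∣ {g} {n} r S′ i) (h (suc i)))
... | x , refl | w , refl = x ∷ w , refl

transversal⇒word : ∀ n g (S : Subset (n * g)) → Transversal (group {n} g) k S →
                   ∃ λ (w : Word n g) → ⟦ w ⟧ ≡ S × ∣ support w ∣ ≡ k
transversal⇒word n g S (∣S∣≡k , h) with ⟦⟧-surjective n g S h
... | w , refl = w , refl , trans (sym (∣⟦w⟧∣≡∣support∣ w)) ∣S∣≡k

-- The extension order on words

infix 4 _⊑_ _≼_

data _⊑_ {A : Set} : Maybe A → Maybe A → Set where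
  nothing⊑ : ∀ {x} → nothing ⊑ x
  just⊑    : ∀ {a} → just a ⊑ just a

_≼_ : Word n g → Word n g → Set
_≼_ = Pointwise _⊑_

row-mono : {x y : Maybe (Fin g)} → x ⊑ y → row x ⊆ row y
row-mono nothing⊑ = ⊥⊆
row-mono just⊑    = id

row-cancel : (x y : Maybe (Fin g)) → row x ⊆ row y → x ⊑ y
row-cancel nothing  y        _ = nothing⊑
row-cancel (just a) nothing  h = contradiction (h (x∈⁅x⁆ a)) ∉⊥
row-cancel (just a) (just b) h with refl ← x∈⁅y⁆⇒x≡y b (h (x∈⁅x⁆ a)) = just⊑

⟦⟧-mono : {w w′ : Word n g} → w ≼ w′ → ⟦ w ⟧ ⊆ ⟦ w′ ⟧
⟦⟧-mono []      = id
⟦⟧-mono (h ∷ hs) = ++-mono-⊆ (row-mono h) (⟦⟧-mono hs)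

⟦⟧-cancel : (w w′ : Word n g) → ⟦ w ⟧ ⊆ ⟦ w′ ⟧ → w ≼ w′
⟦⟧-cancel []      []        _ = []
⟦⟧-cancel (x ∷ w) (x′ ∷ w′) h =
  row-cancel x x′ (++-⊆ˡ h) ∷ ⟦⟧-cancel w w′ (++-⊆ʳ (row x) (row x′) h)

∣support∣-mono : {w w′ : Word n g} → w ≼ w′ → ∣ support w ∣ ≤ ∣ support w′ ∣
∣support∣-mono []                                = z≤n
∣support∣-mono (nothing⊑ {x = nothing} ∷ h) = ∣support∣-mono h
∣support∣-mono (nothing⊑ {x = just _}  ∷ h) = m≤n⇒m≤1+n (∣support∣-mono h)
∣support∣-mono (just⊑ ∷ h)                  = s≤s (∣support∣-mono h)

≼∧∣support∣≡⇒≡ : {w w′ : Word n g} → w ≼ w′ → ∣ support w′ ∣ ≡ ∣ support w ∣ → w ≡ w′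
≼∧∣support∣≡⇒≡ []                           _ = refl
≼∧∣support∣≡⇒≡ (nothing⊑ {x = nothing} ∷ h) e = cong (nothing ∷_) (≼∧∣support∣≡⇒≡ h e)
≼∧∣support∣≡⇒≡ (nothing⊑ {x = just _}  ∷ h) e =
  contradiction (≤-trans (≤-reflexive e) (∣support∣-mono h)) 1+n≰n
≼∧∣support∣≡⇒≡ (just⊑ ∷ h) e = cong (_ ∷_) (≼∧∣support∣≡⇒≡ h (suc-injective e))

⟦⟧-injective : (w w′ : Word n g) → ⟦ w ⟧ ≡ ⟦ w′ ⟧ → w ≡ w′
⟦⟧-injective w w′ e =
  ≼∧∣support∣≡⇒≡ (⟦⟧-cancel w w′ (λ {x} → subst (x ∈_) e))
    (trans (sym (∣⟦w⟧∣≡∣support∣ w′)) (trans (cong ∣_∣ (sym e)) (∣⟦w⟧∣≡∣support∣ w)))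

-- At the first position where only `w′` has a letter, the surplus of one is used up, so the
-- remaining parts have supports of equal size and coincide.
≼-cover : {w w′ : Word n g} → w ≼ w′ → ∣ support w′ ∣ ≡ suc ∣ support w ∣ →
          ∃ λ i → ∃ λ a → lookup w i ≡ nothing × w′ ≡ w [ i ]≔ just a
≼-cover (nothing⊑ {x = nothing} ∷ h) e with ≼-cover h e
... | i , a , free , refl = suc i , a , free , refl
≼-cover (nothing⊑ {x = just a} ∷ h) e =
  zero , a , refl , cong (just a ∷_) (sym (≼∧∣support∣≡⇒≡ h (suc-injective e)))
≼-cover (just⊑ ∷ h) e with ≼-cover h (suc-injective e)
... | i , a , free , refl = suc i , a , free , refl

≼-extend : (w : Word n g) (i : Fin n) {a : Fin g} → lookup w i ≡ nothing →
           w ≼ w [ i ]≔ just a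
≼-extend (nothing ∷ w) zero    _ = nothing⊑ ∷ Pointwise.refl ⊑-refl
  where
  ⊑-refl : ∀ {x} → x ⊑ x
  ⊑-refl {nothing} = nothing⊑
  ⊑-refl {just _}  = just⊑
≼-extend (nothing ∷ w) (suc i) e = nothing⊑ ∷ ≼-extend w i e
≼-extend (just _  ∷ w) (suc i) e = just⊑ ∷ ≼-extend w i e

total-extend : (w : Word n g) (i : Fin n) (a : Fin g) → lookup w i ≡ nothing →
               total (w [ i ]≔ just a) ≡ toℕ a + total w
total-extend (nothing ∷ w) zero    a _ = refl
total-extend (nothing ∷ w) (suc i) a e = total-extend w i a e
total-extend (just b  ∷ w) (suc i) a e = begin
  toℕ b + total (w [ i ]≔ just a) ≡⟨ cong (toℕ b +_) (total-extend w i a e) ⟩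
  toℕ b + (toℕ a + total w)       ≡⟨ +-assoc (toℕ b) (toℕ a) (total w) ⟨
  toℕ b + toℕ a + total w         ≡⟨ cong (_+ total w) (+-comm (toℕ b) (toℕ a)) ⟩
  toℕ a + toℕ b + total w         ≡⟨ +-assoc (toℕ a) (toℕ b) (total w) ⟩
  toℕ a + (toℕ b + total w)       ∎
  where open ≡-Reasoning

free⇒outside : (w : Word n g) (i : Fin n) → lookup w i ≡ nothing →
               lookup (support w) i ≡ outside
free⇒outside w i e = trans (lookup-map i is-just w) (cong is-just e)

outside⇒free : (w : Word n g) (i : Fin n) → lookup (support w) i ≡ outside →
               lookup w i ≡ nothing
outside⇒free (nothing ∷ w) zero    _ = refl
outside⇒free (_ ∷ w)       (suc i) e = outside⇒free w i e

-- Steiner systems and g-fold large sets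

System : ℕ → Set
System n = Subset n → Bool

-- Points of `J` are excluded explicitly, since for them `J [ i ]≔ inside` is `J` itself.
extensions : System n → Subset n → Subset n
extensions D J = tabulate λ i → not (lookup J i) ∧ D (J [ i ]≔ inside)

-- Only the values of `D` on sets of size `t + 1` are constrained; these sets are the potential
-- blocks.
IsSteiner : ℕ → System n → Set
IsSteiner t D = ∀ J → ∣ J ∣ ≡ t → ∣ extensions D J ∣ ≡ 1

steiner⇒∃! : (D : System n) → IsSteiner t D → ∀ J → ∣ J ∣ ≡ t →
             ∃! _≡_ λ i → lookup J i ≡ outside × D (J [ i ]≔ inside) ≡ true
steiner⇒∃! D steiner J ∣J∣≡t with ∣p∣≡1⇒∃! (extensions D J) (steiner J ∣J∣≡t)
... | i , i∈ , unique = i , out i∈ , unique ∘ into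
  where
  test : Fin _ → Bool
  test j = not (lookup J j) ∧ D (J [ j ]≔ inside)

  out : ∀ {j} → lookup (tabulate test) j ≡ inside →
        lookup J j ≡ outside × D (J [ j ]≔ inside) ≡ true
  out {j} e with lookup J j | trans (sym (lookup∘tabulate test j)) e
  ... | outside | e′ = refl , e′

  into : ∀ {j} → lookup J j ≡ outside × D (J [ j ]≔ inside) ≡ true →
         lookup (tabulate test) j ≡ inside
  into {j} (j∉ , e) =
    trans (lookup∘tabulate test j) (cong₂ (λ a b → not a ∧ b) j∉ e)

containing : Vec (System n) m → Subset n → Subset m
containing Ds I = map (λ D → D I) Ds

record FoldedLargeSet (n t g : ℕ) : Set where
  field
    size    : ℕ
    systems : Vec (System n) size
    steiner : All (IsSteiner t) systems
    covered : ∀ I → ∣ I ∣ ≡ suc t → ∣ containing systems I ∣ ≡ g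

infixr 5 _⊎_

_⊎_ : ∀ {g h} → FoldedLargeSet n t g → FoldedLargeSet n t h →
      FoldedLargeSet n t (g + h)
E ⊎ F = record
  { systems = E.systems ++ F.systems
  ; steiner = Allₚ.++⁺ E.steiner F.steiner
  ; covered = λ I e → begin
      ∣ containing (E.systems ++ F.systems) I ∣
        ≡⟨ cong ∣_∣ (map-++ (λ D → D I) E.systems F.systems) ⟩
      ∣ containing E.systems I ++ containing F.systems I ∣
        ≡⟨ ∣p++q∣≡∣p∣+∣q∣ (containing E.systems I) (containing F.systems I) ⟩
      ∣ containing E.systems I ∣ + ∣ containing F.systems I ∣
        ≡⟨ cong₂ _+_ (E.covered I e) (F.covered I e) ⟩
      _ ∎
  }
  where
  module E = FoldedLargeSet E
  module F = FoldedLargeSet F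
  open ≡-Reasoning

derivedSystem : System (suc n) → System n
derivedSystem D p = D (inside ∷ p)

derived : FoldedLargeSet (suc n) (suc t) g → FoldedLargeSet n t g
derived F = record
  { systems = map derivedSystem systems
  -- The adjoined point lies in `inside ∷ J`, so its entry in `extensions` is `outside`, and the
  -- count reduces to that of the derived system.
  ; steiner = Allₚ.map⁺ (All.map (λ steiner J e → steiner (inside ∷ J) (cong suc e)) steiner)
  ; covered = λ I e →
      trans (cong ∣_∣ (sym (map-∘ (λ D → D I) derivedSystem systems)))
            (covered (inside ∷ I) (cong suc e))
  }
  where open FoldedLargeSet F

-- From a folded large set to a large set of H-designs

module _ .{{_ : NonZero g}} (F : FoldedLargeSet n t g) where
  open FoldedLargeSet F

  InCell : Fin size → Word n g → Set
  InCell j w = lookup systems j (support w) ≡ true ×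
               rank (containing systems (support w)) j ≡ total w % g

  Cell : Fin size → Subset (n * g) → Set
  Cell j S = ∃ λ (w : Word n g) → ⟦ w ⟧ ≡ S × ∣ support w ∣ ≡ suc t × InCell j w

  lookup-containing : ∀ I j → lookup (containing systems I) j ≡ lookup systems j I
  lookup-containing I j = lookup-map j (λ D → D I) systems

  -- By `covered`, exactly `g` systems contain the support, so their ranks exhaust the residues
  -- modulo `g`.
  cell-unique : (w : Word n g) → ∣ support w ∣ ≡ suc t → ∃! _≡_ λ j → InCell j w
  cell-unique w e
    with select (containing systems (support w)) (total w % g)
                (≤-trans (m%n<n (total w) g) (≤-reflexive (sym (covered (support w) e))))
  ... | j , (j∈ , r) , unique =
    j , (trans (sym (lookup-containing (support w) j)) j∈ , r) ,
    λ { {j′} (D , r′) → unique (trans (lookup-containing (support w) j′) D , r′) }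

  -- The Steiner property fixes the new position, hence the new support and the rank of `j`; that
  -- rank is the residue of the new total and so fixes the letter.
  extension-unique : (w : Word n g) → ∣ support w ∣ ≡ t → ∀ j →
    ∃! _≡_ λ w′ → w ≼ w′ × ∣ support w′ ∣ ≡ suc t × InCell j w′
  extension-unique w e j
    with steiner⇒∃! (lookup systems j) (Allₚ.lookup⁺ steiner j) (support w) e
  ... | i , (i∉ , I∈D) , i-unique = w′ , (≼-extend w i free , e′ , inCell) , unique
    where
    I = support w [ i ]≔ inside

    free : lookup w i ≡ nothing
    free = outside⇒free w i i∉

    ∣I∣≡1+t : ∣ I ∣ ≡ suc t
    ∣I∣≡1+t = trans (∣p[i]≔inside∣ (support w) i i∉) (cong suc e)

    r = rank (containing systems I) j

    r<g : r < g
    r<g = subst (r <_) (covered I ∣I∣≡1+t)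
            (rank<∣p∣ (containing systems I) j (trans (lookup-containing I j) I∈D))

    letter = +-%-solve g (total w) r r<g
    w′     = w [ i ]≔ just (proj₁ letter)

    support-extend : ∀ {i′ a} → support (w [ i′ ]≔ just a) ≡ support w [ i′ ]≔ inside
    support-extend {i′} = map-[]≔ is-just w i′

    e′ : ∣ support w′ ∣ ≡ suc t
    e′ = trans (cong ∣_∣ support-extend) ∣I∣≡1+t

    inCell : InCell j w′
    inCell = trans (cong (lookup systems j) support-extend) I∈D , (begin
      rank (containing systems (support w′)) j
        ≡⟨ cong (λ p → rank (containing systems p) j) support-extend ⟩
      r
        ≡⟨ proj₁ (proj₂ letter) ⟨
      (toℕ (proj₁ letter) + total w) % g
        ≡⟨ cong (_% g) (total-extend w i _ free) ⟨
      total w′ % g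
        ∎)
      where open ≡-Reasoning

    unique : ∀ {v} → w ≼ v × ∣ support v ∣ ≡ suc t × InCell j v → w′ ≡ v
    unique {v} (w≼v , e″ , D , rank≡)
      with ≼-cover w≼v (trans e″ (cong suc (sym e)))
    ... | i′ , b , free′ , refl
      -- The support of `v` is a block through the support of `w`, so its new position is `i`; only
      -- the letter `b` remains to be compared.
      with refl ← i-unique (free⇒outside w i′ free′ ,
                            trans (cong (lookup systems j) (sym support-extend)) D) =
      cong (λ a → w [ i ]≔ just a) (proj₂ (proj₂ letter) (begin
        (toℕ b + total w) % g
          ≡⟨ cong (_% g) (total-extend w i b free) ⟨
        total (w [ i ]≔ just b) % g
          ≡⟨ rank≡ ⟨
        rank (containing systems (support (w [ i ]≔ just b))) j
          ≡⟨ cong (λ p → rank (containing systems p) j) support-extend ⟩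
        r
          ∎))
      where open ≡-Reasoning

  cell-isHDesign : ∀ j → IsHDesign n g (suc t) t (group g) (Cell j)
  cell-isHDesign j = record
    { isGroupPartition  = group-isGroupPartition n g
    ; block-transversal = λ { _ (w , refl , e , _) → ⟦w⟧-transversal w e }
    ; block-unique      = block-unique
    }
    where
    block-unique : ∀ S → Transversal (group {n} g) t S → ∃! _≡_ λ b → Cell j b × S ⊆ b
    block-unique S S∈ with transversal⇒word n g S S∈
    ... | w , refl , e with extension-unique w e j
    ... | w′ , (w≼w′ , e′ , inCell) , unique =
      ⟦ w′ ⟧ , ((w′ , refl , e′ , inCell) , ⟦⟧-mono w≼w′) ,
      λ { ((v , refl , e″ , inCell′) , w⊆v) →
            cong ⟦_⟧ (unique (⟦⟧-cancel w v w⊆v , e″ , inCell′)) }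

  -- The word `w₀` provides a transversal t-set; completing it within each cell gives the block
  -- required by `nonempty`.
  foldedLargeSet⇒LH : (w : Word n g) → ∣ support w ∣ ≡ t → LH n g (suc t) t
  foldedLargeSet⇒LH w₀ e₀ = record
    { G                = group g
    ; isGroupPartition = group-isGroupPartition n g
    ; m                = size
    ; B                = Cell
    ; isHDesign        = cell-isHDesign
    ; nonempty         = nonempty
    ; partition        = partition
    }
    where
    nonempty : ∀ j → ∃ (Cell j)
    nonempty j with extension-unique w₀ e₀ j
    ... | w , (_ , e , inCell) , _ = ⟦ w ⟧ , w , refl , e , inCell

    partition : ∀ S → Transversal (group {n} g) (suc t) S → ∃! _≡_ λ j → Cell j S
    partition S S∈ with transversal⇒word n g S S∈
    ... | w , refl , e with cell-unique w e
    ... | j , inCell , unique =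
      j , (w , refl , e , inCell) ,
      λ { {j′} (v , v≡w , _ , inCell′) →
            -- The word of a transversal is unique, so membership of `v` in a cell carries over to
            -- `w`.
            unique (subst (InCell j′) (⟦⟧-injective v w v≡w) inCell′) }

-- Folded large sets of S(5,6,12)

-- Branching on the size as well confines the enumeration to sets of size `k`: for 12 points, 792
-- sets of size 5 and 924 of size 6.
everySubset : ∀ n → ℕ → (Subset n → Bool) → Bool
everySubset zero    zero    P = P []
everySubset zero    (suc k) P = true
everySubset (suc n) zero    P = everySubset n zero (P ∘ (outside ∷_))
everySubset (suc n) (suc k) P =
  everySubset n k (P ∘ (inside ∷_)) ∧ everySubset n (suc k) (P ∘ (outside ∷_))

everySubset-sound : (P : Subset n → Bool) → everySubset n k P ≡ true →
                    ∀ p → ∣ p ∣ ≡ k → P p ≡ true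
everySubset-sound {zero}          P h []            refl = h
everySubset-sound {suc n} {zero}  P h (outside ∷ p) e    =
  everySubset-sound (P ∘ (outside ∷_)) h p e
everySubset-sound {suc n} {suc k} P h (inside ∷ p)  e    =
  everySubset-sound (P ∘ (inside ∷_)) (∧-conicalˡ _ _ h) p (suc-injective e)
everySubset-sound {suc n} {suc k} P h (outside ∷ p) e    =
  everySubset-sound (P ∘ (outside ∷_))
    (∧-conicalʳ (everySubset n k (P ∘ (inside ∷_))) _ h) p e

≡ᵇ-sound : ∀ a b → (a ≡ᵇ b) ≡ true → a ≡ b
≡ᵇ-sound a b e = ≡ᵇ⇒≡ a b (Equivalence.from T-≡ e)

isSteinerᵇ : ℕ → System n → Bool
isSteinerᵇ {n} t D = everySubset n t λ J → ∣ extensions D J ∣ ≡ᵇ 1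

allSteinerᵇ : ℕ → Vec (System n) m → Bool
allSteinerᵇ t []       = true
allSteinerᵇ t (D ∷ Ds) = isSteinerᵇ t D ∧ allSteinerᵇ t Ds

allSteinerᵇ-sound : (Ds : Vec (System n) m) → allSteinerᵇ t Ds ≡ true →
                    All (IsSteiner t) Ds
allSteinerᵇ-sound []       _ = []
allSteinerᵇ-sound (D ∷ Ds) h =
  (λ J e → ≡ᵇ-sound _ 1
     (everySubset-sound (λ p → ∣ extensions D p ∣ ≡ᵇ 1) (∧-conicalˡ _ _ h) J e)) ∷
  allSteinerᵇ-sound Ds (∧-conicalʳ (isSteinerᵇ _ D) _ h)

coveredᵇ : ℕ → ℕ → Vec (System n) m → Bool
coveredᵇ {n} k g Ds = everySubset n k λ I → ∣ containing Ds I ∣ ≡ᵇ g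

checked : (Ds : Vec (System n) m) → allSteinerᵇ t Ds ≡ true →
          coveredᵇ (suc t) g Ds ≡ true → FoldedLargeSet n t g
checked Ds h₁ h₂ = record
  { systems = Ds
  ; steiner = allSteinerᵇ-sound Ds h₁
  ; covered = λ I e →
      ≡ᵇ-sound _ _ (everySubset-sound (λ p → ∣ containing Ds p ∣ ≡ᵇ _) h₂ I e)
  }

-- A set A of labels is encoded as 2 ^ Σ_{l ∈ A} 2 ^ l, so that a family of sets
-- becomes a number, in which membership is a test of one binary digit.
weight : ℕ → ℕ
weight zero    = 2
weight (suc l) = weight l * weight l

code : Vec ℕ n → Subset n → ℕ
code []       []            = 1
code (x ∷ xs) (inside  ∷ p) = x * code xs p
code (_ ∷ xs) (outside ∷ p) = code xs p

-- For `d` equal to 2 ^ e this reads the binary digit of `N` at position e. Matching on `suc` makes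
-- the divisor visibly nonzero.
digit : ℕ → ℕ → Bool
digit N zero      = false
digit N d@(suc _) = N / d % 2 ≡ᵇ 1

rotate : ∀ {A : Set} → Vec A n → Vec A n
rotate []       = []
rotate (x ∷ xs) = xs ∷ʳ x

rotations : ∀ {A : Set} → Vec A n → Vec (Vec A n) n
rotations {n} xs = iterate rotate xs n

-- Representatives, under translation, of the blocks of an S(4,5,11) on ℤ/11.
-- Adjoining the point 11 to the blocks, and adding the complements of the
-- resulting sets, gives an S(5,6,12).
basePentads : List (Subset 11)
basePentads =
  (i ∷ i ∷ i ∷ i ∷ o ∷ i ∷ o ∷ o ∷ o ∷ o ∷ o ∷ []) ∷
  (i ∷ i ∷ o ∷ o ∷ i ∷ i ∷ i ∷ o ∷ o ∷ o ∷ o ∷ []) ∷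
  (i ∷ i ∷ o ∷ i ∷ i ∷ o ∷ o ∷ i ∷ o ∷ o ∷ o ∷ []) ∷
  (i ∷ o ∷ i ∷ o ∷ i ∷ o ∷ i ∷ i ∷ o ∷ o ∷ o ∷ []) ∷
  (i ∷ o ∷ o ∷ i ∷ o ∷ i ∷ i ∷ i ∷ o ∷ o ∷ o ∷ []) ∷
  (i ∷ i ∷ o ∷ i ∷ o ∷ o ∷ i ∷ o ∷ i ∷ o ∷ o ∷ []) ∷ []
  where
  i = inside
  o = outside

hexads : List (Subset 12)
hexads = List.concatMap (λ P → (P ∷ʳ inside) ∷ (∁ P ∷ʳ outside) ∷ [])
           (List.concatMap (λ P → toList (rotations P)) basePentads)

-- The 132 hexads are distinct and so have distinct powers of 2 as codes; the sum involves no
-- carries, and its digits 1 mark exactly the hexads.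
hexadCode : ℕ
hexadCode = sum (List.map (code (tabulate (weight ∘ toℕ))) hexads)

-- The image of the family of sets coded by N under a relabelling: a set of
-- positions is a block when the labels in these positions form a member.
relabelled : ℕ → Vec ℕ n → System n
relabelled N labels = test (map weight labels)
  where
  test : Vec ℕ _ → System _
  test weights p = digit N (code weights p)

-- Found by prescribing an automorphism of order 11 and solving for the orbits;
-- the first two relabellings give systems invariant under it, and the second
-- one occurs twice.
twofoldLabels : Vec (Vec ℕ 12) 14
twofoldLabels =
  (0 ∷ 1 ∷ 2 ∷ 3 ∷ 4 ∷ 5 ∷ 6 ∷ 7 ∷ 8 ∷ 9 ∷ 10 ∷ 11 ∷ []) ∷
  (0 ∷ 1 ∷ 2 ∷ 3 ∷ 4 ∷ 10 ∷ 9 ∷ 5 ∷ 11 ∷ 6 ∷ 8 ∷ 7 ∷ []) ∷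
  (0 ∷ 1 ∷ 2 ∷ 3 ∷ 4 ∷ 10 ∷ 9 ∷ 5 ∷ 11 ∷ 6 ∷ 8 ∷ 7 ∷ []) ∷
  map (_∷ʳ 5) (rotations (0 ∷ 1 ∷ 2 ∷ 3 ∷ 4 ∷ 9 ∷ 6 ∷ 10 ∷ 11 ∷ 8 ∷ 7 ∷ []))

-- Found by prescribing an automorphism of order 7.
threefoldLabels : Vec (Vec ℕ 12) 21
threefoldLabels =
  map (_++ 6 ∷ 10 ∷ 8 ∷ 7 ∷ 5 ∷ []) (rotations (0 ∷ 1 ∷ 2 ∷ 3 ∷ 4 ∷ 11 ∷ 9 ∷ [])) ++
  map (_++ 10 ∷ 11 ∷ 7 ∷ 9 ∷ 6 ∷ []) (rotations (0 ∷ 1 ∷ 2 ∷ 3 ∷ 4 ∷ 8 ∷ 5 ∷ [])) ++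
  map (_++ 5 ∷ 9 ∷ 10 ∷ 11 ∷ 7 ∷ []) (rotations (0 ∷ 1 ∷ 2 ∷ 3 ∷ 4 ∷ 8 ∷ 6 ∷ []))

-- An S(5,6,12) contains 132 of the 924 six-element sets, so a g-fold large set has 7g members: 14
-- here and 21 for `threefold`. Each `refl` evaluates an exhaustive check.
twofold : FoldedLargeSet 12 5 2
twofold = checked (map (relabelled hexadCode) twofoldLabels) refl refl

threefold : FoldedLargeSet 12 5 3
threefold = checked (map (relabelled hexadCode) threefoldLabels) refl refl

folded : ∀ k → FoldedLargeSet 12 5 (2 + k)
folded zero          = twofold
folded (suc zero)    = threefold
folded (suc (suc k)) = twofold ⊎ folded k

-- A word with exactly `t` letters, serving as `w₀`.
initialWord : ∀ n t {g} → Word (t + n) (suc g)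
initialWord n t = replicate t (just zero) ++ replicate n nothing

theorem24 : ∀ (g : ℕ) → 2 ≤ g → g ∉ (3 ∷ 5 ∷ 7 ∷ 9 ∷ 11 ∷ 13 ∷ []) →
    LH 11 g 5 4 × LH 12 g 6 5
theorem24 (suc (suc k)) _ _ =
  -- Both initial words have 7 empty positions, as 11 - 4 = 12 - 5 = 7.
  foldedLargeSet⇒LH (derived (folded k)) (initialWord 7 4) refl ,
  foldedLargeSet⇒LH (folded k) (initialWord 7 5) refl
theorem24 (suc zero) (s≤s ()) _
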